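{- For fixed integers $a,b\geq 1$, $$\sum_{k\geq 0}\alpha^{a+b-k}\binom{a+b}{k}\left\langle {k \atop a-1}\right\rangle_{\alpha}=\sum_{k\geq 0}\alpha^{a+b-k}\binom{a+b}{k}\left\langle {k \atop b-1}\right\rangle_{\alpha},$$ where by convention $\left\langle {0\atop 0}\right\rangle_{\alpha}=1$.
   Context: $\mathfrak{S}_m$ is the set of permutations $\sigma=\sigma_1\cdots\sigma_m$ of $\{1,\dots,m\}$. $\mathrm{asc}(\sigma)$ is the number of ascents of $\sigma$, i.e. indices $i\in\{1,\dots,m-1\}$ with $\sigma_i<\sigma_{i+1}$. $\mathrm{RLmin}(\sigma)$ is the number of right-to-left minima of $\sigma$, i.e. letters $\sigma_i$ such that $\sigma_j>\sigma_i$ for every $j>i$. The Stirling-Eulerian number (a polynomial in $\alpha$) is defined by $$\left\langle {m \atop k}\right\rangle_{\alpha}=\sum_{\sigma\in\mathfrak{S}_m,\ \mathrm{asc}(\sigma)=k}\alpha^{\mathrm{RLmin}(\sigma)},$$ an empty sum being $0$. The sums over $k$ in the claim are finite since $\binom{a+b}{k}=0$ for $k>a+b$.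
   Formalization: The convention ⟨0,0⟩ = 1 is replaced by ⟨0,0⟩ = 0: with the value 1 the identity fails for a = 1, b = 2, where it reads 4α³+3α²+α = 3α³+3α²+α; the value matters only when a or b is 1. -}

module Defs where

open import Algebra.Bundles using (CommutativeRing)
open import Data.Bool using (if_then_else_)
open import Data.List using (List; []; _∷_; applyUpTo; cartesianProductWith; filter; foldr; map)
open import Data.List.Relation.Unary.All using (all?)
import Data.List.Relation.Unary.Unique.DecPropositional as Unique
open import Data.Nat using (ℕ; zero; suc; _+_; _<?_; _≟_)
open import Relation.Nullary.Decidable using (does)

words : List ℕ → ℕ → List (List ℕ)
words letters zero    = [] ∷ []
words letters (suc n) = cartesianProductWith _∷_ letters (words letters n)

-- One-line notation: the words of length m over {1, …, m} with distinct
-- letters, each listed exactly once.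
𝔖 : ℕ → List (List ℕ)
𝔖 m = filter (Unique.unique? _≟_) (words (applyUpTo suc m) m)

asc : List ℕ → ℕ
asc []          = 0
asc (x ∷ [])    = 0
asc (x ∷ y ∷ w) = (if does (x <? y) then 1 else 0) + asc (y ∷ w)

RLmin : List ℕ → ℕ
RLmin []      = 0
RLmin (x ∷ w) = (if does (all? (x <?_) w) then 1 else 0) + RLmin w

-- The indeterminate α is an arbitrary element of an arbitrary commutative
-- ring R; R = ℤ[α] gives the polynomials themselves.
module StirlingEulerian {c ℓ} (R : CommutativeRing c ℓ) (α : CommutativeRing.Carrier R) where

  open CommutativeRing R using (Carrier; 0#; semiring) renaming (_+_ to _⊕_)
  open import Algebra.Properties.Semiring.Exp semiring using (_^_)

  permutationSum : ℕ → ℕ → Carrier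
  permutationSum m k =
    foldr _⊕_ 0# (map (λ σ → α ^ RLmin σ) (filter (λ σ → asc σ ≟ k) (𝔖 m)))

  -- The value at (0 , 0) is a convention.  It is 0 here, as in the symmetrical
  -- Eulerian identity of Chung, Graham and Knuth (the case α = 1).  The sum over
  -- 𝔖 0, which contains only the empty word, would give 1, and with that value
  --   ∑ₖ α^(a+b-k) (a+b choose k) ⟨ k , a-1 ⟩ = ∑ₖ α^(a+b-k) (a+b choose k) ⟨ k , b-1 ⟩
  -- fails: for a = 1 and b = 2 it would read 4α³ + 3α² + α = 3α³ + 3α² + α.
  ⟨_,_⟩ : ℕ → ℕ → Carrier
  ⟨ zero , zero ⟩ = 0#
  ⟨ m    , k    ⟩ = permutationSum m k

{-# OPTIONS --safe #-}
module Submission where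

-- Inserting the letter m + 1 into the permutations of 1, …, m shows that
--   G(x,t) = 1 + ∑ t^(asc σ + 1) α^(RLmin σ) x^m / m!   (m ≥ 1, σ ∈ 𝔖 m)
-- satisfies (1 - tx) G_x = t(1 - t) G_t + αtG.  Hence H = e^(αx) G satisfies
--   (1 - tx) H_x = t(1 - t) H_t + α(1 + t)H - αtxH.
-- With J(a,b) = (a+b)! [t^a x^(a+b)] H this reads
--   J(a+1,b+1) + (a+b+1)α J(a,b) = (a+1+α) J(a+1,b) + (b+1+α) J(a,b+1),
-- which is invariant under exchanging a and b, as are the boundary values
-- J(n,0) = J(0,n) = αⁿ; so J is symmetric.  For a ≥ 1 the left-hand sum of the
-- theorem is J(a,b).

open import Defs
open import Algebra.Bundles using (CommutativeRing)
open import Data.Bool using (Bool; true; false; T; if_then_else_)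
open import Data.Empty using (⊥-elim)
open import Data.Fin using (Fin; toℕ; fromℕ; inject₁)
open import Data.Fin.Properties using (toℕ<n; toℕ-fromℕ; toℕ-inject₁)
open import Data.List using (List; []; _∷_; _++_; applyUpTo; concatMap; filter; foldr; length; map)
open import Data.List.Properties
  using (++-identityʳ; applyUpTo-∷ʳ; filter-all; filter-accept; filter-reject; length-applyUpTo; length-++; ∷-injective; ∷-injectiveʳ)
open import Data.List.Membership.Propositional using (_∈_; _∉_; find; lose)
open import Data.List.Membership.Propositional.Properties
  using (∈-∃++; ∈-++⁺ˡ; ∈-++⁺ʳ; ∈-map⁺; ∈-map⁻; ∈-filter⁺; ∈-filter⁻; ∈-concatMap⁺; ∈-concatMap⁻;
         ∈-cartesianProductWith⁺; ∈-cartesianProductWith⁻)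
open import Data.List.Relation.Binary.Permutation.Propositional
  using (_↭_; prep; swap; ↭-refl; ↭-sym; ↭-trans; ↭-reflexive; ↭⇒↭ₛ)
open import Data.List.Relation.Binary.Permutation.Propositional.Properties
  using (∈-resp-↭; All-resp-↭; ↭-length; drop-mid; shift; ∷↭∷ʳ)
import Data.List.Relation.Binary.Permutation.Setoid.Properties as ↭ₛ
open import Data.List.Relation.Binary.Subset.Propositional using (_⊆_)
open import Data.List.Relation.Unary.All as All using (All; []; _∷_; all?)
open import Data.List.Relation.Unary.All.Properties using () renaming (applyUpTo⁺₁ to All-applyUpTo⁺)
open import Data.List.Relation.Unary.AllPairs using ([]; _∷_)
open import Data.List.Relation.Unary.Any using (here; there)
open import Data.List.Relation.Unary.Unique.Propositional using (Unique)
open import Data.List.Relation.Unary.Unique.Propositional.Properties as Uniqueₚ using (Unique[x∷xs]⇒x∉xs)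
import Data.List.Relation.Unary.Unique.DecPropositional as UniqueDec
open import Data.Nat using (ℕ; zero; suc; _+_; _∸_; _≥_; _<_; _≤_; z≤n; s≤s; _≟_; _<?_; _≡ᵇ_; ≤-pred)
open import Data.Nat.Combinatorics using (_C_; nCk+nC[k+1]≡[n+1]C[k+1]; k>n⇒nCk≡0)
import Data.Nat.Properties as ℕₚ
open import Data.Nat.Properties
  using (+-suc; +-∸-assoc; <-irrefl; <-asym; <⇒≢; m<n⇒m<1+n; n<1+n; suc-injective; m≤n⇒m≤1+n; ≡ᵇ⇒≡)
open import Data.Product using (∃; _,_; proj₁; proj₂) renaming (_×_ to _∧_)
open import Function using (_∘_; mk⇔)
open import Relation.Binary.PropositionalEquality as ≡ using (_≡_; _≢_)
open import Relation.Nullary.Decidable using (does; Dec; ¬?; dec-true; dec-false; does-⇔)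
import Algebra.Properties.Semiring.Sum as Sum
import Algebra.Properties.Semiring.Mult as Mult
import Algebra.Properties.Semiring.Exp as Exp

-- Lists without repetition, up to rearrangement.

module _ {a} {A : Set a} where

  Unique-resp-↭ : {xs ys : List A} → xs ↭ ys → Unique xs → Unique ys
  Unique-resp-↭ p = ↭ₛ.Unique-resp-↭ (≡.setoid A) (↭⇒↭ₛ p)

  -- Take the head `x` out of `ys` at one occurrence. The tail of `xs` stays inside the remainder
  -- because `x` does not recur in it.
  unique-⊆⇒↭++ : {xs ys : List A} → Unique xs → xs ⊆ ys → ∃ λ zs → ys ↭ xs ++ zs
  unique-⊆⇒↭++ {[]}     {ys} _ _ = ys , ↭-refl
  unique-⊆⇒↭++ {x ∷ xs} u@(_ ∷ u′) xs⊆ys with ∈-∃++ (xs⊆ys (here ≡.refl))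
  ... | us , vs , ≡.refl with unique-⊆⇒↭++ u′ xs⊆us++vs
    where
    xs⊆us++vs : xs ⊆ us ++ vs
    xs⊆us++vs z∈xs with ∈-resp-↭ (shift x us vs) (xs⊆ys (there z∈xs))
    ... | here ≡.refl = ⊥-elim (Unique[x∷xs]⇒x∉xs u z∈xs)
    ... | there z∈    = z∈
  ... | zs , p = zs , ↭-trans (shift x us vs) (prep x p)

  unique-⊆-length⇒↭ : {xs ys : List A} → Unique xs → xs ⊆ ys → length xs ≡ length ys → xs ↭ ys
  unique-⊆-length⇒↭ {xs} u xs⊆ys eq with unique-⊆⇒↭++ u xs⊆ys
  ... | []     , p = ↭-sym (↭-trans p (↭-reflexive (++-identityʳ xs)))
  ... | z ∷ zs , p = ⊥-elim (m≢m+1+n (length xs) (≡.trans eq (≡.trans (↭-length p) (length-++ xs))))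
    where
    m≢m+1+n : ∀ m {n} → m ≢ m + suc n
    m≢m+1+n (suc m) = m≢m+1+n m ∘ suc-injective

  -- A leftover entry `z` would also lie in `xs` and so occur twice in `ys`.
  unique-⊆-⊇⇒↭ : {xs ys : List A} → Unique xs → Unique ys → xs ⊆ ys → ys ⊆ xs → xs ↭ ys
  unique-⊆-⊇⇒↭ {xs} ux uy xs⊆ys ys⊆xs with unique-⊆⇒↭++ ux xs⊆ys
  ... | []     , p = ↭-sym (↭-trans p (↭-reflexive (++-identityʳ xs)))
  ... | z ∷ zs , p = ⊥-elim (Unique[x∷xs]⇒x∉xs (Unique-resp-↭ (↭-trans p (shift z xs zs)) uy)
                       (∈-++⁺ˡ (ys⊆xs (∈-resp-↭ (↭-sym p) (∈-++⁺ʳ xs (here ≡.refl))))))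

  unique-concatMap : ∀ {b} {B : Set b} (f : A → List B) {xs} →
    (∀ {x} → x ∈ xs → Unique (f x)) →
    (∀ {x y z} → x ∈ xs → y ∈ xs → z ∈ f x → z ∈ f y → x ≡ y) →
    Unique xs → Unique (concatMap f xs)
  unique-concatMap f {[]}     _ _ _ = []
  unique-concatMap f {x ∷ xs} uf disj u@(_ ∷ u′) =
    Uniqueₚ.++⁺ (uf (here ≡.refl))
      (unique-concatMap f (uf ∘ there) (λ p q → disj (there p) (there q)) u′)
      λ (z∈fx , z∈rest) →
        let y , y∈xs , z∈fy = find (∈-concatMap⁻ f {xs = xs} z∈rest)
        in Unique[x∷xs]⇒x∉xs u (≡.subst (_∈ xs) (≡.sym (disj (here ≡.refl) (there y∈xs) z∈fx z∈fy)) y∈xs)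

-- Inserting a letter into a word.

module _ {a} {A : Set a} where

  insertions : A → List A → List (List A)
  insertions x []      = (x ∷ []) ∷ []
  insertions x (y ∷ w) = (x ∷ y ∷ w) ∷ map (y ∷_) (insertions x w)

  ∈-insertions⁺ : ∀ {x} us {vs} → us ++ x ∷ vs ∈ insertions x (us ++ vs)
  ∈-insertions⁺ []       {[]}    = here ≡.refl
  ∈-insertions⁺ []       {_ ∷ _} = here ≡.refl
  ∈-insertions⁺ (u ∷ us) {vs}    = there (∈-map⁺ (u ∷_) (∈-insertions⁺ us))

  ∈-insertions⇒↭ : ∀ {x} w {v} → v ∈ insertions x w → v ↭ x ∷ w
  ∈-insertions⇒↭ []      (here ≡.refl) = ↭-refl
  ∈-insertions⇒↭ (y ∷ w) (here ≡.refl) = ↭-refl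
  ∈-insertions⇒↭ (y ∷ w) (there v∈) with ∈-map⁻ (y ∷_) v∈
  ... | v′ , v′∈ , ≡.refl = ↭-trans (prep y (∈-insertions⇒↭ w v′∈)) (swap y _ ↭-refl)

  -- Only the first insertion starts with `x`; the others start with `y`, which differs from `x`. If
  -- `x` occurred in `w`, adjacent gaps could give the same word.
  insertions-unique : ∀ {x} w → x ∉ w → Unique (insertions x w)
  insertions-unique []      _   = [] ∷ []
  insertions-unique {x} (y ∷ w) x∉w =
    All.tabulate (λ v∈ eq → x∉w (here (heads (∈-map⁻ (y ∷_) v∈) eq)))
    ∷ Uniqueₚ.map⁺ ∷-injectiveʳ (insertions-unique w (x∉w ∘ there))
    where
    heads : ∀ {v} → (∃ λ v′ → (v′ ∈ insertions x w) ∧ (v ≡ y ∷ v′)) → x ∷ y ∷ w ≡ v → x ≡ y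
    heads (_ , _ , ≡.refl) eq = proj₁ (∷-injective eq)

-- Deleting x recovers w, hence lists of insertions into distinct words are disjoint.
delete-insertion : ∀ {x} w {v} → x ∉ w → v ∈ insertions x w → filter (λ z → ¬? (x ≟ z)) v ≡ w
delete-insertion {x} [] x∉w (here ≡.refl) = filter-reject (λ z → ¬? (x ≟ z)) (λ x≢x → x≢x ≡.refl)
delete-insertion {x} (y ∷ w) x∉w (here ≡.refl) =
  ≡.trans (filter-reject (λ z → ¬? (x ≟ z)) (λ x≢x → x≢x ≡.refl))
          (filter-all (λ z → ¬? (x ≟ z)) (All.tabulate λ z∈ x≡z → x∉w (≡.subst (_∈ y ∷ w) (≡.sym x≡z) z∈)))
delete-insertion {x} (y ∷ w) x∉w (there v∈) with ∈-map⁻ (y ∷_) v∈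
... | v′ , v′∈ , ≡.refl =
  ≡.trans (filter-accept (λ z → ¬? (x ≟ z)) (x∉w ∘ here))
          (≡.cong (y ∷_) (delete-insertion w (x∉w ∘ there) v′∈))

-- The list `𝔖 m` and its growth by the letter m + 1.

letters : ℕ → List ℕ
letters m = applyUpTo suc m

letters-suc : ∀ m → letters (suc m) ↭ suc m ∷ letters m
letters-suc m = ↭-trans (↭-reflexive (≡.sym (applyUpTo-∷ʳ suc m))) (↭-sym (∷↭∷ʳ (suc m) (letters m)))

letters-unique : ∀ m → Unique (letters m)
letters-unique m = Uniqueₚ.applyUpTo⁺₁ suc m (λ i<j _ → <⇒≢ (s≤s i<j))

letters-< : ∀ m → All (_< suc m) (letters m)
letters-< m = All-applyUpTo⁺ suc m s≤s

∈-words⁺ : ∀ {ls} w → w ⊆ ls → w ∈ words ls (length w)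
∈-words⁺ []      _   = here ≡.refl
∈-words⁺ (x ∷ w) w⊆ = ∈-cartesianProductWith⁺ _∷_ (w⊆ (here ≡.refl)) (∈-words⁺ w (w⊆ ∘ there))

∈-words⁻ : ∀ {ls} n {w} → w ∈ words ls n → (w ⊆ ls) ∧ (length w ≡ n)
∈-words⁻ zero    (here ≡.refl) = (λ ()) , ≡.refl
∈-words⁻ {ls} (suc n) w∈ with ∈-cartesianProductWith⁻ _∷_ ls (words ls n) w∈
... | x , v , x∈ , v∈ , ≡.refl =
  (λ { (here ≡.refl) → x∈ ; (there z∈) → proj₁ (∈-words⁻ n v∈) z∈ }) , ≡.cong suc (proj₂ (∈-words⁻ n v∈))

words-unique : ∀ {ls} n → Unique ls → Unique (words ls n)
words-unique zero    _ = [] ∷ []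
words-unique (suc n) u = Uniqueₚ.cartesianProductWith⁺ _∷_ ∷-injective u (words-unique n u)

𝔖-unique : ∀ m → Unique (𝔖 m)
𝔖-unique m = Uniqueₚ.filter⁺ (UniqueDec.unique? _≟_) (words-unique m (letters-unique m))

-- Distinct letters, `m` in number, chosen from `m` letters exhaust them.
∈-𝔖⁻ : ∀ m {w} → w ∈ 𝔖 m → w ↭ letters m
∈-𝔖⁻ m w∈ with ∈-filter⁻ (UniqueDec.unique? _≟_) {xs = words (letters m) m} w∈
... | w∈words , u with ∈-words⁻ m w∈words
... | w⊆ , len = unique-⊆-length⇒↭ u w⊆ (≡.trans len (≡.sym (length-applyUpTo suc m)))

∈-𝔖⁺ : ∀ m {w} → w ↭ letters m → w ∈ 𝔖 m
∈-𝔖⁺ m {w} p = ∈-filter⁺ (UniqueDec.unique? _≟_)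
  (≡.subst (λ n → w ∈ words (letters m) n) (≡.trans (↭-length p) (length-applyUpTo suc m)) (∈-words⁺ w (∈-resp-↭ p)))
  (Unique-resp-↭ (↭-sym p) (letters-unique m))

∈-𝔖⇒< : ∀ m {w} → w ∈ 𝔖 m → All (_< suc m) w
∈-𝔖⇒< m w∈ = All-resp-↭ (↭-sym (∈-𝔖⁻ m w∈)) (letters-< m)

∈-𝔖⇒length : ∀ m {w} → w ∈ 𝔖 m → length w ≡ m
∈-𝔖⇒length m w∈ = ≡.trans (↭-length (∈-𝔖⁻ m w∈)) (length-applyUpTo suc m)

-- Both lists are free of repetition, so comparing members suffices: `split` deletes the letter m +
-- 1 and `merge` inserts it. The two orders differ in general, but sums do not see the order.
𝔖-suc : ∀ m → 𝔖 (suc m) ↭ concatMap (insertions (suc m)) (𝔖 m)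
𝔖-suc m = unique-⊆-⊇⇒↭ (𝔖-unique (suc m))
  (unique-concatMap (insertions (suc m))
    (λ w∈ → insertions-unique _ (∉𝔖 w∈))
    (λ v∈ w∈ z∈v z∈w → ≡.trans (≡.sym (delete-insertion _ (∉𝔖 v∈) z∈v)) (delete-insertion _ (∉𝔖 w∈) z∈w))
    (𝔖-unique m))
  split merge
  where
  ∉𝔖 : ∀ {w} → w ∈ 𝔖 m → suc m ∉ w
  ∉𝔖 w∈ sm∈ = <-irrefl ≡.refl (All.lookup (∈-𝔖⇒< m w∈) sm∈)

  split : 𝔖 (suc m) ⊆ concatMap (insertions (suc m)) (𝔖 m)
  split w∈ with ↭-trans (∈-𝔖⁻ (suc m) w∈) (letters-suc m)
  ... | p with ∈-∃++ (∈-resp-↭ (↭-sym p) (here ≡.refl))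
  ... | us , vs , ≡.refl =
    ∈-concatMap⁺ (insertions (suc m)) (lose (∈-𝔖⁺ m (drop-mid us [] p)) (∈-insertions⁺ us))

  merge : concatMap (insertions (suc m)) (𝔖 m) ⊆ 𝔖 (suc m)
  merge w∈ with find (∈-concatMap⁻ (insertions (suc m)) {xs = 𝔖 m} w∈)
  ... | v , v∈ , w∈v = ∈-𝔖⁺ (suc m)
    (↭-trans (∈-insertions⇒↭ v w∈v) (↭-trans (prep (suc m) (∈-𝔖⁻ m v∈)) (↭-sym (letters-suc m))))

module Identity {c ℓ} (R : CommutativeRing c ℓ) (α : CommutativeRing.Carrier R) where

  open CommutativeRing R hiding (zero) renaming (_+_ to _⊕_)
  open Sum semiring
  open Mult semiring
  open Exp semiring
  open StirlingEulerian R α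
  open import Algebra.Properties.Group +-group using () renaming (∙-cancelʳ to +-cancelʳ)
  open import Algebra.Solver.Ring.NaturalCoefficients.Default commutativeSemiring
  open import Relation.Binary.Reasoning.Setoid setoid

  -- Natural numbers in the ring and sums over lists.

  ι : ℕ → Carrier
  ι n = n × 1#

  ι-+ : ∀ m n → ι (m + n) ≈ ι m ⊕ ι n
  ι-+ = ×-homo-+ 1#

  sumOver : ∀ {a} {A : Set a} → (A → Carrier) → List A → Carrier
  sumOver f xs = foldr _⊕_ 0# (map f xs)

  sumOver-++ : ∀ {a} {A : Set a} (f : A → Carrier) (xs ys : List A) →
               sumOver f (xs ++ ys) ≈ sumOver f xs ⊕ sumOver f ys
  sumOver-++ f []       ys = sym (+-identityˡ _)
  sumOver-++ f (x ∷ xs) ys = trans (+-congˡ (sumOver-++ f xs ys)) (sym (+-assoc _ _ _))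

  module _ {a} {A : Set a} where

    sumOver-cong : {f g : A → Carrier} (xs : List A) → (∀ {x} → x ∈ xs → f x ≈ g x) → sumOver f xs ≈ sumOver g xs
    sumOver-cong []       _   = refl
    sumOver-cong (x ∷ xs) f≈g = +-cong (f≈g (here ≡.refl)) (sumOver-cong xs (f≈g ∘ there))

    sumOver-+ : (f g : A → Carrier) (xs : List A) → sumOver (λ x → f x ⊕ g x) xs ≈ sumOver f xs ⊕ sumOver g xs
    sumOver-+ f g []       = sym (+-identityˡ 0#)
    sumOver-+ f g (x ∷ xs) = trans (+-congˡ (sumOver-+ f g xs))
      (solve 4 (λ a b c d → (a :+ b) :+ (c :+ d) := (a :+ c) :+ (b :+ d)) refl
        (f x) (g x) (sumOver f xs) (sumOver g xs))

    sumOver-* : (k : Carrier) (f : A → Carrier) (xs : List A) → sumOver (λ x → k * f x) xs ≈ k * sumOver f xs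
    sumOver-* k f []       = sym (zeroʳ k)
    sumOver-* k f (x ∷ xs) = trans (+-congˡ (sumOver-* k f xs)) (sym (distribˡ k (f x) (sumOver f xs)))

    sumOver-↭ : (f : A → Carrier) {xs ys : List A} → xs ↭ ys → sumOver f xs ≈ sumOver f ys
    sumOver-↭ f p = ↭ₛ.foldr-commMonoid setoid +-isCommutativeMonoid
      (↭ₛ.map⁺ (≡.setoid A) setoid (reflexive ∘ ≡.cong f) (↭⇒↭ₛ p))

    sumOver-map : ∀ {b} {B : Set b} (f : B → Carrier) (h : A → B) (xs : List A) →
                  sumOver f (map h xs) ≈ sumOver (f ∘ h) xs
    sumOver-map f h []       = refl
    sumOver-map f h (x ∷ xs) = +-congˡ (sumOver-map f h xs)

    sumOver-concatMap : ∀ {b} {B : Set b} (f : B → Carrier) (h : A → List B) (xs : List A) →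
                        sumOver f (concatMap h xs) ≈ sumOver (sumOver f ∘ h) xs
    sumOver-concatMap f h []       = refl
    sumOver-concatMap f h (x ∷ xs) = trans (sumOver-++ f (h x) (concatMap h xs)) (+-congˡ (sumOver-concatMap f h xs))

    sumOver-filter : ∀ {p} {P : A → Set p} (P? : ∀ x → Dec (P x)) (f : A → Carrier) (xs : List A) →
                     sumOver f (filter P? xs) ≈ sumOver (λ x → if does (P? x) then f x else 0#) xs
    sumOver-filter P? f []       = refl
    sumOver-filter P? f (x ∷ xs) with does (P? x)
    ... | true  = +-congˡ (sumOver-filter P? f xs)
    ... | false = trans (sumOver-filter P? f xs) (sym (+-identityˡ _))

  -- Ascents and right-to-left minima under insertion of the largest letter.

  [_] : Bool → ℕ
  [ b ] = if b then 1 else 0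

  -- A larger letter never stops `y` from being a right-to-left minimum, so an inserted maximum
  -- leaves the status of the letters before it unchanged.
  all-<-insertion : ∀ {x y} w {v} → y < x → v ∈ insertions x w →
                    does (all? (y <?_) v) ≡ does (all? (y <?_) w)
  all-<-insertion {x} {y} w {v} y<x v∈ = does-⇔
    (mk⇔ (λ y<v → All.tail (All-resp-↭ (∈-insertions⇒↭ w v∈) y<v))
         (λ y<w → All-resp-↭ (↭-sym (∈-insertions⇒↭ w v∈)) (y<x ∷ y<w)))
    (all? (y <?_) v) (all? (y <?_) w)

  -- Inserting the largest letter x at the end creates an ascent and a
  -- right-to-left minimum, inserting it into an ascent changes neither statistic,
  -- and inserting it into a descent creates an ascent.  The number of descents of
  -- y ∷ w is length w minus asc (y ∷ w), which is why the term
  -- ι (asc (y ∷ w)) * _ stands on the left.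
  sum-insertions-after-head : ∀ {x} (φ : ℕ → ℕ → Carrier) y w → y < x → All (_< x) w →
    let a = asc (y ∷ w)
        r = RLmin (y ∷ w)
    in sumOver (λ v → φ (asc (y ∷ v)) (RLmin (y ∷ v))) (insertions x w) ⊕ ι a * φ (suc a) r
       ≈ φ (suc a) (suc r) ⊕ ι a * φ a r ⊕ ι (length w) * φ (suc a) r
  sum-insertions-after-head {x} φ y [] y<x [] rewrite dec-true (y <? x) y<x =
    solve 3 (λ p q s → (p :+ con 0) :+ con 0 :* q := p :+ con 0 :* s :+ con 0 :* q) refl (φ 1 2) (φ 1 1) (φ 0 1)
  sum-insertions-after-head {x} φ y (z ∷ w) y<x (z<x ∷ w<x) = begin
    φ (asc (y ∷ x ∷ z ∷ w)) (RLmin (y ∷ x ∷ z ∷ w))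
      ⊕ sumOver (λ v → φ (asc (y ∷ v)) (RLmin (y ∷ v))) (map (z ∷_) (insertions x w)) ⊕ ι a * φ (suc a) r
      ≈⟨ +-congʳ (+-cong (reflexive (≡.cong₂ φ asc-first RLmin-first)) rest) ⟩
    φ (suc a′) r ⊕ S ⊕ ι a * φ (suc a) r
      ≈⟨ step (does (y <? z)) IH ⟩
    φ (suc a) (suc r) ⊕ ι a * φ a r ⊕ ι (length (z ∷ w)) * φ (suc a) r ∎
    where
    a = asc (y ∷ z ∷ w)
    a′ = asc (z ∷ w)
    r = RLmin (y ∷ z ∷ w)
    e = [ does (y <? z) ]
    δ = [ does (all? (y <?_) (z ∷ w)) ]
    -- The head `y` adds `e` and `δ` wherever `x` is placed after `z`. Quantifying over `φ` lets the
    -- induction absorb these constants into `φ′`.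
    φ′ : ℕ → ℕ → Carrier
    φ′ p q = φ (e + p) (δ + q)
    S = sumOver (λ v → φ′ (asc (z ∷ v)) (RLmin (z ∷ v))) (insertions x w)
    r′ = RLmin (z ∷ w)
    IH : S ⊕ ι a′ * φ (e + suc a′) r ≈ φ (e + suc a′) (δ + suc r′) ⊕ ι a′ * φ a r ⊕ ι (length w) * φ (e + suc a′) r
    IH = sum-insertions-after-head φ′ z w z<x w<x
    asc-first : asc (y ∷ x ∷ z ∷ w) ≡ suc a′
    asc-first rewrite dec-true (y <? x) y<x | dec-false (x <? z) (<-asym z<x) = ≡.refl
    RLmin-first : RLmin (y ∷ x ∷ z ∷ w) ≡ r
    RLmin-first rewrite all-<-insertion (z ∷ w) y<x (here ≡.refl)
                      | dec-false (all? (x <?_) (z ∷ w)) (λ x<zw → <-asym z<x (All.head x<zw)) = ≡.refl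
    rest : sumOver (λ v → φ (asc (y ∷ v)) (RLmin (y ∷ v))) (map (z ∷_) (insertions x w)) ≈ S
    rest = trans (sumOver-map _ (z ∷_) (insertions x w)) (sumOver-cong (insertions x w) λ {v} v∈ →
      reflexive (≡.cong (λ b → φ (e + asc (z ∷ v)) ([ b ] + RLmin (z ∷ v)))
        (all-<-insertion (z ∷ w) y<x (there (∈-map⁺ (z ∷_) v∈)))))
    -- The gap between `y` and `z` is the one that the induction hypothesis does not count. Filling
    -- it gives `suc a′` ascents: this is `a` if `y < z`, where an ascent is split, and `suc a`
    -- otherwise.
    step : ∀ b → let k = [ b ] in
      S ⊕ ι a′ * φ (k + suc a′) r
        ≈ φ (k + suc a′) (δ + suc r′) ⊕ ι a′ * φ (k + a′) r ⊕ ι (length w) * φ (k + suc a′) r →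
      φ (suc a′) r ⊕ S ⊕ ι (k + a′) * φ (suc (k + a′)) r
        ≈ φ (suc (k + a′)) (suc r) ⊕ ι (k + a′) * φ (k + a′) r ⊕ ι (length (z ∷ w)) * φ (suc (k + a′)) r
    step true ih rewrite +-suc δ r′ =
      trans (solve 4 (λ p s q t → p :+ s :+ (con 1 :+ t) :* q := (s :+ t :* q) :+ (p :+ q)) refl
              (φ (suc a′) r) S (φ (suc (suc a′)) r) (ι a′))
      (trans (+-congʳ ih)
        (solve 5 (λ p q t l u → (u :+ t :* p :+ l :* q) :+ (p :+ q) := u :+ (con 1 :+ t) :* p :+ (con 1 :+ l) :* q) refl
              (φ (suc a′) r) (φ (suc (suc a′)) r) (ι a′) (ι (length w)) (φ (suc (suc a′)) (suc r))))
    step false ih rewrite +-suc δ r′ =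
      trans (solve 3 (λ q s t → q :+ s :+ t :* q := (s :+ t :* q) :+ q) refl
              (φ (suc a′) r) S (ι a′))
      (trans (+-congʳ ih)
        (solve 5 (λ p q t l u → (u :+ t :* p :+ l :* q) :+ q := u :+ t :* p :+ (con 1 :+ l) :* q) refl
              (φ a′ r) (φ (suc a′) r) (ι a′) (ι (length w)) (φ (suc a′) (suc r))))

  -- With `≡ᵇ`, `term (suc j) (suc p) r` computes to `term j p r`, so one more ascent lowers the
  -- index by one. The test in `weight (suc j)` likewise computes to the one that filters
  -- `permutationSum`.
  term : ℕ → ℕ → ℕ → Carrier
  term j p r = if p ≡ᵇ j then α ^ r else 0#

  -- The term vanishes unless `p` equals `j`. This trades the number of ascents, which varies with
  -- the word, for an index that can be taken out of the sum over words.
  term-index : ∀ j p r → ι p * term j p r ≈ ι j * term j p r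
  term-index j p r with p ≡ᵇ j in eq
  ... | true  = *-congʳ (reflexive (≡.cong ι (≡ᵇ⇒≡ p j (≡.subst T (≡.sym eq) _))))
  ... | false = trans (zeroʳ (ι p)) (sym (zeroʳ (ι j)))

  term-suc : ∀ j p r → term j p (suc r) ≈ α * term j p r
  term-suc j p r with p ≡ᵇ j
  ... | true  = refl
  ... | false = sym (zeroʳ α)

  -- Indexing by asc + 1 makes weight 0 vanish, matching the shift k = a - 1.
  weight : ℕ → List ℕ → Carrier
  weight j w = term j (suc (asc w)) (RLmin w)

  -- One gap is missing from `sum-insertions-after-head`: in front of `y` the letter `x` makes a
  -- descent and is no right-to-left minimum, so it contributes `Y`.
  sum-insertions : ∀ {x} j y w → All (_< x) (y ∷ w) →
    sumOver (weight (suc j)) (insertions x (y ∷ w)) ⊕ ι j * weight j (y ∷ w)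
    ≈ ι (suc j) * weight (suc j) (y ∷ w) ⊕ (ι (length (y ∷ w)) ⊕ α) * weight j (y ∷ w)
  sum-insertions {x} j y w (y<x ∷ w<x) = begin
    weight (suc j) (x ∷ y ∷ w) ⊕ sumOver (weight (suc j)) (map (y ∷_) (insertions x w)) ⊕ ι j * X
      ≈⟨ +-cong (+-cong (reflexive (≡.cong₂ (term (suc j)) asc-first RLmin-first)) (sumOver-map _ (y ∷_) (insertions x w)))
                (sym (term-index j (suc a) r)) ⟩
    Y ⊕ S ⊕ ι (suc a) * X
      ≈⟨ solve 4 (λ y s p x → y :+ s :+ (con 1 :+ p) :* x := (s :+ p :* x) :+ (x :+ y)) refl Y S (ι a) X ⟩
    (S ⊕ ι a * X) ⊕ (X ⊕ Y)
      ≈⟨ +-congʳ (sum-insertions-after-head (λ p → term (suc j) (suc p)) y w y<x w<x) ⟩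
    (term j (suc a) (suc r) ⊕ ι a * Y ⊕ ι (length w) * X) ⊕ (X ⊕ Y)
      ≈⟨ +-congʳ (+-congʳ (+-congʳ (term-suc j (suc a) r))) ⟩
    (α * X ⊕ ι a * Y ⊕ ι (length w) * X) ⊕ (X ⊕ Y)
      ≈⟨ solve 5 (λ x y p l t → (t :* x :+ p :* y :+ l :* x) :+ (x :+ y)
                             := (con 1 :+ p) :* y :+ ((con 1 :+ l) :+ t) :* x) refl X Y (ι a) (ι (length w)) α ⟩
    ι (suc a) * Y ⊕ (ι (suc (length w)) ⊕ α) * X
      ≈⟨ +-congʳ (term-index (suc j) (suc a) r) ⟩
    ι (suc j) * Y ⊕ (ι (suc (length w)) ⊕ α) * X ∎
    where
    a = asc (y ∷ w)
    r = RLmin (y ∷ w)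
    X = weight j (y ∷ w)
    Y = weight (suc j) (y ∷ w)
    S = sumOver (λ v → weight (suc j) (y ∷ v)) (insertions x w)
    asc-first : suc (asc (x ∷ y ∷ w)) ≡ suc a
    asc-first rewrite dec-false (x <? y) (<-asym y<x) = ≡.refl
    RLmin-first : RLmin (x ∷ y ∷ w) ≡ r
    RLmin-first rewrite dec-false (all? (x <?_) (y ∷ w)) (λ x<yw → <-asym y<x (All.head x<yw)) = ≡.refl

  -- The recurrence for the coefficients of G.

  -- The coefficients of G = 1 + ∑ t^(asc σ + 1) α^(RLmin σ) x^m / m!.
  coeff : ℕ → ℕ → Carrier
  coeff zero    zero    = 1#
  coeff (suc m) zero    = 0#
  coeff m       (suc j) = ⟨ m , j ⟩

  permutationSum-weight : ∀ m j → permutationSum m j ≈ sumOver (weight (suc j)) (𝔖 m)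
  permutationSum-weight m j = sumOver-filter (λ σ → asc σ ≟ j) (λ σ → α ^ RLmin σ) (𝔖 m)

  -- Positive length is essential: at length 0 the sum over words would count the empty word at
  -- index 1, whereas `coeff` puts it at index 0.
  coeff-weight : ∀ m j → coeff (suc m) j ≈ sumOver (weight j) (𝔖 (suc m))
  coeff-weight m (suc j) = permutationSum-weight (suc m) j
  coeff-weight m zero    = sym (sumOver-zero (𝔖 (suc m)))
    where
    sumOver-zero : ∀ xs → sumOver (weight 0) xs ≈ 0#
    sumOver-zero []       = refl
    sumOver-zero (x ∷ xs) = trans (+-identityˡ _) (sumOver-zero xs)

  coeff-zero-suc : ∀ j → coeff zero (suc j) ≈ 0#
  coeff-zero-suc zero    = refl
  coeff-zero-suc (suc j) = refl

  -- Coefficient of t^(j+1) x^m / m! in (1 - tx) G_x = t(1 - t) G_t + αtG, with negative terms moved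
  -- across so that semiring reasoning is enough. For `m ≥ 1` it is `sum-insertions` summed over
  -- `𝔖 m`.
  coeff-rec : ∀ m j → coeff (suc m) (suc j) ⊕ ι j * coeff m j
                      ≈ ι (suc j) * coeff m (suc j) ⊕ (ι m ⊕ α) * coeff m j
  -- Here `coeff 1 1` computes to `α * 1# ⊕ 0#`. The convention `⟨ 0 , 0 ⟩ = 0` matters: the value 1
  -- would add 1 to the right-hand side.
  coeff-rec zero zero = solve 1 (λ t → (t :* con 1 :+ con 0) :+ con 0 :* con 1
                                    := (con 1 :+ con 0) :* con 0 :+ (con 0 :+ t) :* con 1) refl α
  coeff-rec zero (suc j) = trans
    (+-cong (refl {x = 0#}) (*-congˡ (coeff-zero-suc j)))
    (trans (solve 2 (λ t p → con 0 :+ (con 1 :+ p) :* con 0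
                             := (con 1 :+ (con 1 :+ p)) :* con 0 :+ (con 0 :+ t) :* con 0) refl α (ι j))
           (+-congˡ (*-congˡ (sym (coeff-zero-suc j)))))
  coeff-rec (suc m) j = begin
    coeff (2 + m) (suc j) ⊕ ι j * coeff (suc m) j
      ≈⟨ +-cong (trans (coeff-weight (suc m) (suc j)) (trans (sumOver-↭ (weight (suc j)) (𝔖-suc (suc m)))
                  (sumOver-concatMap (weight (suc j)) (insertions (2 + m)) 𝔖₁)))
                (trans (*-congˡ (coeff-weight m j)) (sym (sumOver-* (ι j) (weight j) 𝔖₁))) ⟩
    sumOver (λ w → sumOver (weight (suc j)) (insertions (2 + m) w)) 𝔖₁ ⊕ sumOver (λ w → ι j * weight j w) 𝔖₁
      ≈⟨ sumOver-+ _ _ 𝔖₁ ⟨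
    sumOver (λ w → sumOver (weight (suc j)) (insertions (2 + m) w) ⊕ ι j * weight j w) 𝔖₁
      ≈⟨ sumOver-cong 𝔖₁ (λ {w} w∈ → pointwise w (∈-𝔖⇒length (suc m) w∈) (∈-𝔖⇒< (suc m) w∈)) ⟩
    sumOver (λ w → ι (suc j) * weight (suc j) w ⊕ (ι (suc m) ⊕ α) * weight j w) 𝔖₁
      ≈⟨ sumOver-+ _ _ 𝔖₁ ⟩
    sumOver (λ w → ι (suc j) * weight (suc j) w) 𝔖₁ ⊕ sumOver (λ w → (ι (suc m) ⊕ α) * weight j w) 𝔖₁
      ≈⟨ +-cong (trans (sumOver-* (ι (suc j)) (weight (suc j)) 𝔖₁) (*-congˡ (sym (coeff-weight m (suc j)))))
                (trans (sumOver-* (ι (suc m) ⊕ α) (weight j) 𝔖₁) (*-congˡ (sym (coeff-weight m j)))) ⟩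
    ι (suc j) * coeff (suc m) (suc j) ⊕ (ι (suc m) ⊕ α) * coeff (suc m) j ∎
    where
    𝔖₁ = 𝔖 (suc m)
    pointwise : ∀ w → length w ≡ suc m → All (_< 2 + m) w →
      sumOver (weight (suc j)) (insertions (2 + m) w) ⊕ ι j * weight j w
      ≈ ι (suc j) * weight (suc j) w ⊕ (ι (suc m) ⊕ α) * weight j w
    pointwise (y ∷ w) ≡.refl w< = sum-insertions j y w w<

  -- Combinatorially, a nonempty word of length `m` has fewer than `m` ascents. The recurrence alone
  -- gives this by induction, every other term in it having index above its length.
  coeff-zero : ∀ m j → m < j → coeff m j ≈ 0#
  coeff-zero zero    (suc j) _         = coeff-zero-suc j
  coeff-zero (suc m) (suc j) (s≤s m<j) = +-cancelʳ (ι j * coeff m j) _ _ (begin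
    coeff (suc m) (suc j) ⊕ ι j * coeff m j ≈⟨ coeff-rec m j ⟩
    ι (suc j) * coeff m (suc j) ⊕ (ι m ⊕ α) * coeff m j
      ≈⟨ +-cong (*-congˡ (coeff-zero m (suc j) (m<n⇒m<1+n m<j))) (*-congˡ (coeff-zero m j m<j)) ⟩
    ι (suc j) * 0# ⊕ (ι m ⊕ α) * 0#
      ≈⟨ solve 3 (λ p q t → (con 1 :+ p) :* con 0 :+ (q :+ t) :* con 0 := con 0 :+ p :* con 0) refl (ι j) (ι m) α ⟩
    0# ⊕ ι j * 0# ≈⟨ +-congˡ (*-congˡ (coeff-zero m j m<j)) ⟨
    0# ⊕ ι j * coeff m j ∎)

  -- For `m ≥ 1` the only contribution is the increasing word, all of whose letters are
  -- right-to-left minima. In the recurrence the terms with factor `ι m` cancel.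
  coeff-diagonal : ∀ m → coeff m m ≈ α ^ m
  coeff-diagonal zero    = refl
  coeff-diagonal (suc m) = +-cancelʳ (ι m * coeff m m) _ _ (begin
    coeff (suc m) (suc m) ⊕ ι m * coeff m m ≈⟨ coeff-rec m m ⟩
    ι (suc m) * coeff m (suc m) ⊕ (ι m ⊕ α) * coeff m m ≈⟨ +-congʳ (*-congˡ (coeff-zero m (suc m) (n<1+n m))) ⟩
    ι (suc m) * 0# ⊕ (ι m ⊕ α) * coeff m m
      ≈⟨ solve 3 (λ p t h → (con 1 :+ p) :* con 0 :+ (p :+ t) :* h := t :* h :+ p :* h) refl (ι m) α (coeff m m) ⟩
    α * coeff m m ⊕ ι m * coeff m m ≈⟨ +-congʳ (*-congˡ (coeff-diagonal m)) ⟩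
    α ^ suc m ⊕ ι m * coeff m m ∎)

  -- Multiplication by e^(αx) as a binomial transform.

  -- (α + E)ⁿ h evaluated at 0, where E is the shift h ↦ h ∘ suc.
  binomialTransform : ℕ → (ℕ → Carrier) → Carrier
  binomialTransform zero    h = h 0
  binomialTransform (suc n) h = α * binomialTransform n h ⊕ binomialTransform n (h ∘ suc)

  -- Pascal's rule: the summands with `n C suc k`, completed by the one at 0, form the α part, and
  -- those with `n C k` form the shifted part.
  binomialTransform-sum : ∀ n h → ∑[ k ≤ n ] (α ^ (n ∸ toℕ k) * ((n C toℕ k) × h (toℕ k))) ≈ binomialTransform n h
  binomialTransform-sum zero h =
    solve 1 (λ x → con 1 :* (x :+ con 0) :+ con 0 := x) refl (h 0)
  binomialTransform-sum (suc n) h = begin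
    head ⊕ ∑[ k ≤ n ] (F (suc n) h (suc (toℕ k)))
      ≈⟨ +-congˡ (trans (sum-cong-≋ {suc n} (pascal ∘ toℕ))
           (∑-distrib-+ {suc n} (λ k → P (toℕ k)) (λ k → F n (h ∘ suc) (toℕ k)))) ⟩
    head ⊕ (∑[ k ≤ n ] P (toℕ k) ⊕ ∑[ k ≤ n ] F n (h ∘ suc) (toℕ k))
      -- `head` is also `P′ 0`, since both binomial coefficients are 1.
      ≈⟨ +-assoc _ _ _ ⟨
    ∑[ k ≤ suc n ] P′ (toℕ k) ⊕ ∑[ k ≤ n ] F n (h ∘ suc) (toℕ k)
      ≈⟨ +-cong scaled (binomialTransform-sum n (h ∘ suc)) ⟩
    α * binomialTransform n h ⊕ binomialTransform n (h ∘ suc) ∎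
    where
    F : ℕ → (ℕ → Carrier) → ℕ → Carrier
    F n h k = α ^ (n ∸ k) * ((n C k) × h k)
    head = F (suc n) h 0
    P′ : ℕ → Carrier
    P′ k = α ^ (suc n ∸ k) * ((n C k) × h k)
    P : ℕ → Carrier
    P k = P′ (suc k)
    pascal : ∀ k → F (suc n) h (suc k) ≈ P k ⊕ F n (h ∘ suc) k
    pascal k = begin
      α ^ (n ∸ k) * ((suc n C suc k) × h (suc k))
        ≈⟨ *-congˡ (×-congˡ (≡.trans (≡.sym (nCk+nC[k+1]≡[n+1]C[k+1] n k)) (ℕₚ.+-comm (n C k) (n C suc k)))) ⟩
      α ^ (n ∸ k) * ((n C suc k + n C k) × h (suc k))
        ≈⟨ *-congˡ (×-homo-+ (h (suc k)) (n C suc k) (n C k)) ⟩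
      α ^ (n ∸ k) * ((n C suc k) × h (suc k) ⊕ (n C k) × h (suc k)) ≈⟨ distribˡ _ _ _ ⟩
      P k ⊕ F n (h ∘ suc) k ∎
    P′-last : P′ (toℕ (fromℕ (suc n))) ≈ 0#
    P′-last = trans (*-congˡ (×-congˡ {h _} (≡.trans (≡.cong (n C_) (toℕ-fromℕ (suc n))) (k>n⇒nCk≡0 (n<1+n n))))) (zeroʳ _)
    -- Truncated subtraction gives `suc n ∸ k = suc (n ∸ k)` only for `k ≤ n`. Hence the top term is
    -- split off; `P′-last` kills it by its binomial coefficient 0.
    P′-scaled : ∀ (k : Fin (suc n)) → P′ (toℕ (inject₁ k)) ≈ α * F n h (toℕ k)
    P′-scaled k rewrite toℕ-inject₁ k | +-∸-assoc 1 (≤-pred (toℕ<n k)) = *-assoc α _ _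
    scaled : ∑[ k ≤ suc n ] P′ (toℕ k) ≈ α * binomialTransform n h
    scaled = begin
      ∑[ k ≤ suc n ] P′ (toℕ k) ≈⟨ sum-init-last {suc n} (P′ ∘ toℕ) ⟩
      ∑[ k ≤ n ] P′ (toℕ (inject₁ k)) ⊕ P′ (toℕ (fromℕ (suc n))) ≈⟨ +-cong (sum-cong-≋ {suc n} P′-scaled) P′-last ⟩
      ∑[ k ≤ n ] (α * F n h (toℕ k)) ⊕ 0# ≈⟨ +-identityʳ _ ⟩
      ∑[ k ≤ n ] (α * F n h (toℕ k)) ≈⟨ *-distribˡ-sum {suc n} α (λ k → F n h (toℕ k)) ⟨
      α * ∑[ k ≤ n ] F n h (toℕ k) ≈⟨ *-congˡ (binomialTransform-sum n h) ⟩
      α * binomialTransform n h ∎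

  binomialTransform-zero : ∀ n {h} → (∀ k → k ≤ n → h k ≈ 0#) → binomialTransform n h ≈ 0#
  binomialTransform-zero zero    h≈0 = h≈0 0 z≤n
  binomialTransform-zero (suc n) h≈0 = trans
    (+-cong (*-congˡ (binomialTransform-zero n (λ k k≤n → h≈0 k (m≤n⇒m≤1+n k≤n))))
            (binomialTransform-zero n (λ k k≤n → h≈0 (suc k) (s≤s k≤n))))
    (trans (+-identityʳ _) (zeroʳ α))

  binomialTransform-cong : ∀ n {h h′} → (∀ k → h k ≈ h′ k) → binomialTransform n h ≈ binomialTransform n h′
  binomialTransform-cong zero    h≈h′ = h≈h′ 0
  binomialTransform-cong (suc n) h≈h′ =
    +-cong (*-congˡ (binomialTransform-cong n h≈h′)) (binomialTransform-cong n (h≈h′ ∘ suc))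

  -- From the recurrence for G to the one for H = e^(αx) G.

  -- Q i 0 j / i! is the coefficient of t^j x^i in e^(αx) G; the second index makes
  -- coeff-rec transfer to Q by induction on i.
  Q : ℕ → ℕ → ℕ → Carrier
  Q i m j = binomialTransform i (λ k → coeff (k + m) j)

  Q-suc : ∀ i m j → Q (suc i) m j ≈ α * Q i m j ⊕ Q i (suc m) j
  Q-suc i m j = +-congˡ (binomialTransform-cong i (λ k → reflexive (≡.cong (λ l → coeff l j) (≡.sym (+-suc k m)))))

  -- The last term is the commutator of the multiplication by m with (α + E)ⁱ.
  Q-rec : ∀ i m j → Q (suc i) (suc m) (suc j) ⊕ ι j * Q (suc i) m j
                    ≈ ι (suc j) * Q (suc i) m (suc j) ⊕ (ι m ⊕ α) * Q (suc i) m j ⊕ ι (suc i) * Q i (suc m) j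
  Q-rec i m j = begin
    Q (suc i) (suc m) (suc j) ⊕ ι j * Q (suc i) m j
      ≈⟨ +-cong (Q-suc i (suc m) (suc j)) (*-congˡ (Q-suc i m j)) ⟩
    (α * Q i (suc m) (suc j) ⊕ Q i (2 + m) (suc j)) ⊕ ι j * (α * Q i m j ⊕ Q i (suc m) j)
      ≈⟨ solve 6 (λ t x y p u v → (t :* x :+ y) :+ p :* (t :* u :+ v) := t :* (x :+ p :* u) :+ (y :+ p :* v)) refl
           α (Q i (suc m) (suc j)) (Q i (2 + m) (suc j)) (ι j) (Q i m j) (Q i (suc m) j) ⟩
    α * (Q i (suc m) (suc j) ⊕ ι j * Q i m j) ⊕ (Q i (2 + m) (suc j) ⊕ ι j * Q i (suc m) j)
      ≈⟨ +-cong (*-congˡ (lower i m)) (lower i (suc m)) ⟩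
    α * (ι (suc j) * Q i m (suc j) ⊕ (ι m ⊕ α) * Q i m j ⊕ D i m)
      ⊕ (ι (suc j) * Q i (suc m) (suc j) ⊕ (ι (suc m) ⊕ α) * Q i (suc m) j ⊕ D i (suc m))
      ≈⟨ solve 9 (λ t p q a b c d e f →
              t :* ((con 1 :+ p) :* a :+ (q :+ t) :* b :+ e) :+ ((con 1 :+ p) :* c :+ ((con 1 :+ q) :+ t) :* d :+ f)
              := (con 1 :+ p) :* (t :* a :+ c) :+ (q :+ t) :* (t :* b :+ d) :+ (d :+ (t :* e :+ f))) refl
           α (ι j) (ι m) (Q i m (suc j)) (Q i m j) (Q i (suc m) (suc j)) (Q i (suc m) j) (D i m) (D i (suc m)) ⟩
    ι (suc j) * (α * Q i m (suc j) ⊕ Q i (suc m) (suc j)) ⊕ (ι m ⊕ α) * (α * Q i m j ⊕ Q i (suc m) j)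
      ⊕ (Q i (suc m) j ⊕ (α * D i m ⊕ D i (suc m)))
      ≈⟨ +-cong (+-cong (*-congˡ (sym (Q-suc i m (suc j)))) (*-congˡ (sym (Q-suc i m j)))) (D-step i) ⟩
    ι (suc j) * Q (suc i) m (suc j) ⊕ (ι m ⊕ α) * Q (suc i) m j ⊕ ι (suc i) * Q i (suc m) j ∎
    where
    -- The commutator term one level down. Its value 0 at `i = 0` lets `lower` cover both
    -- `coeff-rec` and the induction hypothesis, which is needed at `m` and at `suc m`.
    D : ℕ → ℕ → Carrier
    D zero    m = 0#
    D (suc i) m = ι (suc i) * Q i (suc m) j
    lower : ∀ i m → Q i (suc m) (suc j) ⊕ ι j * Q i m j ≈ ι (suc j) * Q i m (suc j) ⊕ (ι m ⊕ α) * Q i m j ⊕ D i m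
    lower zero    m = trans (coeff-rec m j) (sym (+-identityʳ _))
    lower (suc i) m = Q-rec i m j
    -- The extra `Q i (suc m) j` comes from `ι (suc m)` exceeding `ι m` by one; it raises the factor
    -- from `ι i` to `ι (suc i)`.
    D-step : ∀ i → Q i (suc m) j ⊕ (α * D i m ⊕ D i (suc m)) ≈ ι (suc i) * Q i (suc m) j
    D-step zero    = solve 2 (λ t x → x :+ (t :* con 0 :+ con 0) := (con 1 :+ con 0) :* x) refl α (Q 0 (suc m) j)
    D-step (suc i) = trans
      (+-congˡ (solve 4 (λ t p x y → t :* (p :* x) :+ p :* y := p :* (t :* x :+ y)) refl
        α (ι (suc i)) (Q i (suc m) j) (Q i (2 + m) j)))
      (trans (+-congˡ (*-congˡ (sym (Q-suc i (suc m) j))))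
        (solve 2 (λ p x → x :+ p :* x := (con 1 :+ p) :* x) refl (ι (suc i)) (Q (suc i) (suc m) j)))

  H : ℕ → ℕ → Carrier
  H n j = Q n 0 j

  -- Coefficient of t^(j+1) x^(n+1) / (n+1)! in the equation for H. It comes from `Q-rec` at
  -- `m = 0`: adding `ι (suc n) * (α * H n j)` turns `Q n 1 j` into `H (suc n) j`, so that only
  -- second index 0 is left.
  H-rec : ∀ n j → H (2 + n) (suc j) ⊕ (ι j * H (suc n) j ⊕ ι (suc n) * (α * H n j))
                  ≈ (ι (suc j) ⊕ α) * H (suc n) (suc j) ⊕ (ι (suc n) ⊕ α) * H (suc n) j
  H-rec n j = begin
    H (2 + n) (suc j) ⊕ (ι j * H (suc n) j ⊕ ι (suc n) * (α * H n j))
      ≈⟨ +-congʳ (Q-suc (suc n) 0 (suc j)) ⟩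
    (α * H (suc n) (suc j) ⊕ Q (suc n) 1 (suc j)) ⊕ (ι j * H (suc n) j ⊕ ι (suc n) * (α * H n j))
      ≈⟨ solve 4 (λ a b c d → (a :+ b) :+ (c :+ d) := (b :+ c) :+ (a :+ d)) refl _ _ _ _ ⟩
    (Q (suc n) 1 (suc j) ⊕ ι j * H (suc n) j) ⊕ (α * H (suc n) (suc j) ⊕ ι (suc n) * (α * H n j))
      ≈⟨ +-congʳ (Q-rec n 0 j) ⟩
    (ι (suc j) * H (suc n) (suc j) ⊕ (0# ⊕ α) * H (suc n) j ⊕ ι (suc n) * Q n 1 j)
      ⊕ (α * H (suc n) (suc j) ⊕ ι (suc n) * (α * H n j))
      ≈⟨ solve 7 (λ t p q a b c d → (p :* a :+ (con 0 :+ t) :* b :+ q :* c) :+ (t :* a :+ q :* (t :* d))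
                   := (p :+ t) :* a :+ (t :* b :+ q :* (t :* d :+ c))) refl
           α (ι (suc j)) (ι (suc n)) (H (suc n) (suc j)) (H (suc n) j) (Q n 1 j) (H n j) ⟩
    (ι (suc j) ⊕ α) * H (suc n) (suc j) ⊕ (α * H (suc n) j ⊕ ι (suc n) * (α * H n j ⊕ Q n 1 j))
      ≈⟨ +-congˡ (+-congˡ (*-congˡ (sym (Q-suc n 0 j)))) ⟩
    (ι (suc j) ⊕ α) * H (suc n) (suc j) ⊕ (α * H (suc n) j ⊕ ι (suc n) * H (suc n) j)
      ≈⟨ +-congˡ (solve 3 (λ t q x → t :* x :+ q :* x := (q :+ t) :* x) refl α (ι (suc n)) (H (suc n) j)) ⟩
    (ι (suc j) ⊕ α) * H (suc n) (suc j) ⊕ (ι (suc n) ⊕ α) * H (suc n) j ∎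

  Q-zero : ∀ i m → Q i (suc m) 0 ≈ 0#
  Q-zero i m = binomialTransform-zero i (λ k _ → reflexive (≡.cong (λ l → coeff l 0) (+-suc k m)))

  -- Index 0 is carried by length 0 alone, so every shifted branch vanishes and only powers of α
  -- remain.
  H-left : ∀ n → H n 0 ≈ α ^ n
  H-left zero    = refl
  H-left (suc n) = trans (Q-suc n 0 0) (trans (+-cong (*-congˡ (H-left n)) (Q-zero n 0)) (+-identityʳ _))

  -- At each step only the shifted branch survives: in the other the index exceeds every length that
  -- occurs.
  Q-top : ∀ i m → Q i m (i + m) ≈ α ^ (i + m)
  Q-top zero    m = coeff-diagonal m
  Q-top (suc i) m = begin
    Q (suc i) m (suc i + m) ≈⟨ Q-suc i m (suc i + m) ⟩
    α * Q i m (suc (i + m)) ⊕ Q i (suc m) (suc (i + m))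
      ≈⟨ +-cong (*-congˡ (binomialTransform-zero i (λ k k≤i → coeff-zero (k + m) (suc (i + m)) (s≤s (ℕₚ.+-monoˡ-≤ m k≤i)))))
                (reflexive (≡.cong (Q i (suc m)) (≡.sym (+-suc i m)))) ⟩
    α * 0# ⊕ Q i (suc m) (i + suc m) ≈⟨ +-cong (zeroʳ α) (Q-top i (suc m)) ⟩
    0# ⊕ α ^ (i + suc m) ≈⟨ +-identityˡ _ ⟩
    α ^ (i + suc m) ≈⟨ ^-congʳ α (+-suc i m) ⟩
    α ^ suc (i + m) ∎

  -- Symmetric coordinates and the symmetry of `J`.

  J : ℕ → ℕ → Carrier
  J a b = H (a + b) a

  J-left : ∀ b → J 0 b ≈ α ^ b
  J-left = H-left

  J-right : ∀ a → J a 0 ≈ α ^ a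
  J-right a = ≡.subst (λ n → H n a ≈ α ^ a) (≡.sym (ℕₚ.+-identityʳ a))
                (≡.subst (λ n → H a n ≈ α ^ n) (ℕₚ.+-identityʳ a) (Q-top a 0))

  -- In `H-rec` at a + b, splitting `ι (suc (a + b))` into 1, `ι a` and `ι b` cancels the
  -- unsymmetric term `ι a * H (suc (a + b)) a` and leaves `ι (suc b) ⊕ α`, the mirror image of the
  -- other factor.
  J-rec : ∀ a b → J (suc a) (suc b) ⊕ ι (suc (a + b)) * (α * J a b)
                  ≈ (ι (suc a) ⊕ α) * J (suc a) b ⊕ (ι (suc b) ⊕ α) * J a (suc b)
  J-rec a b rewrite +-suc a b = +-cancelʳ (ι a * H (suc (a + b)) a) _ _ (begin
    (H (2 + (a + b)) (suc a) ⊕ ι (suc (a + b)) * (α * H (a + b) a)) ⊕ ι a * H (suc (a + b)) a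
      ≈⟨ solve 3 (λ x y z → (x :+ y) :+ z := x :+ (z :+ y)) refl _ _ _ ⟩
    H (2 + (a + b)) (suc a) ⊕ (ι a * H (suc (a + b)) a ⊕ ι (suc (a + b)) * (α * H (a + b) a))
      ≈⟨ H-rec (a + b) a ⟩
    (ι (suc a) ⊕ α) * H (suc (a + b)) (suc a) ⊕ (ι (suc (a + b)) ⊕ α) * H (suc (a + b)) a
      ≈⟨ +-congˡ (*-congʳ (+-congʳ (+-congˡ (ι-+ a b)))) ⟩
    (ι (suc a) ⊕ α) * H (suc (a + b)) (suc a) ⊕ (1# ⊕ (ι a ⊕ ι b) ⊕ α) * H (suc (a + b)) a
      ≈⟨ solve 5 (λ t p q x y → x :+ (con 1 :+ (p :+ q) :+ t) :* y := (x :+ ((con 1 :+ q) :+ t) :* y) :+ p :* y) refl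
           α (ι a) (ι b) ((ι (suc a) ⊕ α) * H (suc (a + b)) (suc a)) (H (suc (a + b)) a) ⟩
    ((ι (suc a) ⊕ α) * H (suc (a + b)) (suc a) ⊕ (ι (suc b) ⊕ α) * H (suc (a + b)) a) ⊕ ι a * H (suc (a + b)) a ∎)

  J-sym : ∀ a b → J a b ≈ J b a
  J-sym zero    b       = trans (J-left b) (sym (J-right b))
  J-sym (suc a) zero    = trans (J-right (suc a)) (sym (J-left (suc a)))
  J-sym (suc a) (suc b) = +-cancelʳ (ι (suc (a + b)) * (α * J a b)) _ _ (begin
    J (suc a) (suc b) ⊕ ι (suc (a + b)) * (α * J a b) ≈⟨ J-rec a b ⟩
    (ι (suc a) ⊕ α) * J (suc a) b ⊕ (ι (suc b) ⊕ α) * J a (suc b)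
      ≈⟨ +-cong (*-congˡ (J-sym (suc a) b)) (*-congˡ (J-sym a (suc b))) ⟩
    (ι (suc a) ⊕ α) * J b (suc a) ⊕ (ι (suc b) ⊕ α) * J (suc b) a ≈⟨ +-comm _ _ ⟩
    (ι (suc b) ⊕ α) * J (suc b) a ⊕ (ι (suc a) ⊕ α) * J b (suc a) ≈⟨ J-rec b a ⟨
    J (suc b) (suc a) ⊕ ι (suc (b + a)) * (α * J b a)
      ≈⟨ +-congˡ (*-cong (×-congˡ (≡.cong suc (ℕₚ.+-comm b a))) (*-congˡ (sym (J-sym a b)))) ⟩
    J (suc b) (suc a) ⊕ ι (suc (a + b)) * (α * J a b) ∎)

  sum-J : ∀ a b →
    ∑[ k ≤ suc a + b ] (α ^ (suc a + b ∸ toℕ k) * (((suc a + b) C toℕ k) × ⟨ toℕ k , a ⟩))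
      ≈ J (suc a) b
  sum-J a b = trans (binomialTransform-sum (suc a + b) (λ k → ⟨ k , a ⟩))
    (binomialTransform-cong (suc a + b) (λ k → ⟨⟩≈coeff k))
    where
    ⟨⟩≈coeff : ∀ k → ⟨ k , a ⟩ ≈ coeff (k + 0) (suc a)
    ⟨⟩≈coeff k = reflexive
      (≡.trans (≡.sym (coeff-shift k)) (≡.cong (λ l → coeff l (suc a)) (≡.sym (ℕₚ.+-identityʳ k))))
      where
      -- The clauses of `coeff` match on the length first, so the equation computes only after a
      -- case split.
      coeff-shift : ∀ m → coeff m (suc a) ≡ ⟨ m , a ⟩
      coeff-shift zero    = ≡.refl
      coeff-shift (suc m) = ≡.refl

theorem4p1 : ∀ {c ℓ} (R : CommutativeRing c ℓ) (α : CommutativeRing.Carrier R)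
               (a b : ℕ) → a ≥ 1 → b ≥ 1 →
               let open CommutativeRing R hiding (_+_)
                   open Sum semiring using (sum⁺-syntax)
                   open Mult semiring using (_×_)
                   open Exp semiring using (_^_)
                   open StirlingEulerian R α using (⟨_,_⟩)
               in (∑[ k ≤ a + b ] (α ^ (a + b ∸ toℕ k) * (((a + b) C toℕ k) × ⟨ toℕ k , a ∸ 1 ⟩)))
                  ≈ (∑[ k ≤ a + b ] (α ^ (a + b ∸ toℕ k) * (((a + b) C toℕ k) × ⟨ toℕ k , b ∸ 1 ⟩)))
theorem4p1 R α (suc a) (suc b) _ _ =
  trans (sum-J a (suc b)) (trans (J-sym (suc a) (suc b)) (sym swapped))
  where
  open CommutativeRing R using (_≈_; trans; sym)
  open Sum (CommutativeRing.semiring R) using (sum⁺-syntax)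
  open Mult (CommutativeRing.semiring R) using (_×_)
  open Exp (CommutativeRing.semiring R) using (_^_)
  open StirlingEulerian R α using (⟨_,_⟩)
  open Identity R α
  swapped : _ ≈ J (suc b) (suc a)
  -- `sum-J` has the two parameters added in the opposite order; the range, the exponent and the
  -- binomial coefficient are rewritten together.
  swapped = ≡.subst
    (λ n → (∑[ k ≤ n ] CommutativeRing._*_ R (α ^ (n ∸ toℕ k)) ((n C toℕ k) × ⟨ toℕ k , b ⟩)) ≈ J (suc b) (suc a))
    (ℕₚ.+-comm (suc b) (suc a)) (sum-J b (suc a))
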